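{- The verification problem for uninterpreted programs that have no nested loops, no conditional branches within loops, and no functions of arity $\ge 2$ in loop bodies can be encoded as the satisfiability problem of $\mathrm{EUF}^n$ formulas: there is an effective procedure which, given such a program $P$, produces an $\mathrm{EUF}^n$ formula $\phi_P$ such that $\phi_P$ is satisfiable if and only if there are a data model $\mathcal{M}$ and an execution of $P$ over $\mathcal{M}$ that reaches the state $\mathit{Fail}$ (so $P$ is correct if and only if $\phi_P$ is unsatisfiable).
   Context: Uninterpreted programs. Over a finite set of program variables and function symbols, statements are $\mathtt{stmt} ::= \mathtt{skip}\mid \mathtt{x:=y}\mid \mathtt{x:=f}(\vec{\mathtt z})\mid \mathtt{assume(cond)}\mid\mathtt{assert(cond)}\mid \mathtt{stmt;stmt}\mid \mathtt{if\,(cond)\,then\,\{stmt\}\,else\,\{stmt\}}\mid\mathtt{while\,(cond)\,\{stmt\}}$, with $\mathtt{cond} ::= \mathtt{x=y}\mid \mathtt{cond}\wedge\mathtt{cond}\mid\neg\mathtt{cond}$, where $\mathtt{x},\mathtt{y}$ are program variables, $\vec{\mathtt z}$ is a tuple of program variables and $\mathtt f$ a function symbol. A data model $\mathcal{M}=(\mathcal{U},\mathcal{I})$ is a set $\mathcal U$ with an interpretation $\mathcal{I}$ of the function symbols on $\mathcal U$; a state maps program variables to elements of $\mathcal U$; the initial values of the variables are unconstrained. Statements have the usual semantics: $\mathtt{assume(c)}$ blocks the execution if $\mathtt c$ is false, and $\mathtt{assert(c)}$ moves to the special state $\mathit{Fail}$ if $\mathtt c$ is false. The verification problem asks whether, for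 every data model $\mathcal M$, no execution of the program over $\mathcal M$ reaches $\mathit{Fail}$. $\mathrm{EUF}^n$ formulas. There is a sort $\mathsf U$ (uninterpreted) and a sort $\mathsf N$ (natural numbers). Terms of sort $\mathsf U$ are $term ::= x\mid f^{lin}(term)\mid g(term,\dots,term)$, with $x$ a variable of sort $\mathsf U$, $f=f_1\circ\cdots\circ f_r$ a finite composition of unary function symbols, $g$ a function symbol of arity $\ge2$, and $lin$ a linear expression with integer coefficients in variables of sort $\mathsf N$ (values required non-negative); $f^k(t)$ means $f$ applied $k$ times to $t$. Formulas are Boolean combinations of equalities between terms. In the encoding of loops, formulas may additionally contain universally quantified index variables $i$ of sort $\mathsf N$, bounded by a loop-count variable $m$ of sort $\mathsf N$ (subformulas of the form $\forall i.\,(i<m\wedge\cdots)\rightarrow\cdots$), linear-arithmetic guards on variables of sort $\mathsf N$, and integer division of such expressions by positive constants. A formula is satisfiable if there are an assignment of natural numbers to its free variables of sort $\mathsf N$, a set $\mathcal U$ with an interpretation of the function symbols, and an assignment of elements of $\mathcal U$ to the variables of sort $\mathsf U$, under which it is true (exponents being read as iterated application). -}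

module Defs where

open import Data.Empty using (⊥)
open import Data.Fin.Base using (Fin)
open import Data.Integer.Base as ℤ using (ℤ; 0ℤ; ∣_∣)
open import Data.Integer.DivMod using (_/ℕ_)
open import Data.List.NonEmpty.Base using (List⁺; foldr)
open import Data.Nat.Base using (ℕ; _≤_; _<_; suc; NonZero)
open import Data.Nat.GeneralisedArithmetic using (iterate)
open import Data.Product.Base using (Σ-syntax; _×_; proj₁; proj₂)
open import Data.Sum.Base using (_⊎_; [_,_]′)
open import Data.Unit.Base using (⊤)
open import Data.Vec.Base using (Vec; []; _∷_; lookup; map; cast; _[_]≔_)
open import Function.Base using (_∘′_)
open import Relation.Binary.PropositionalEquality.Core using (_≡_; sym)
open import Relation.Nullary.Negation.Core using (¬_)

infix  7 _==_ _·_ _div_ _≤ᵍ_ _≐_ _≔_ _≔_⟨_⟩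
infix  6 not_ ¬ᵍ_ ~_
infixr 5 _and_ _∧ᵍ_ _∧_
infixr 4 _∨_
infixr 3 _⊃_ _⨾_
infixl 6 _⊕_

record Signature : Set where
  field
    symbols : ℕ
    arity   : Fin symbols → ℕ

  Symbol : Set
  Symbol = Fin symbols

  Unary : Set
  Unary = Σ[ f ∈ Symbol ] arity f ≡ 1

open Signature public

record Model (S : Signature) : Set₁ where
  field
    Carrier : Set
    interp  : (f : Symbol S) → Vec Carrier (arity S f) → Carrier

  apply₁ : Unary S → Carrier → Carrier
  apply₁ f a = interp (proj₁ f) (cast (sym (proj₂ f)) (a ∷ []))

  compose : List⁺ (Unary S) → Carrier → Carrier
  compose = foldr (λ f h → apply₁ f ∘′ h) apply₁

open Model public

------------------------------------------------------------------------
-- Uninterpreted programs over v program variables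

data Cond (v : ℕ) : Set where
  _==_ : (x y : Fin v) → Cond v
  _and_ : (c d : Cond v) → Cond v
  not_ : (c : Cond v) → Cond v

data Stmt (S : Signature) (v : ℕ) : Set where
  skip          : Stmt S v
  _≔_           : (x y : Fin v) → Stmt S v
  _≔_⟨_⟩        : (x : Fin v) (f : Symbol S) (zs : Vec (Fin v) (arity S f)) → Stmt S v
  assume assert : (c : Cond v) → Stmt S v
  _⨾_           : (p q : Stmt S v) → Stmt S v
  if_then_else_ : (c : Cond v) (p q : Stmt S v) → Stmt S v
  while_loop_   : (c : Cond v) (p : Stmt S v) → Stmt S v

module _ {S : Signature} {v : ℕ} (M : Model S) where

  State : Set
  State = Vec (Carrier M) v

  Holds : Cond v → State → Set
  Holds (x == y)  s = lookup s x ≡ lookup s y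
  Holds (c and d) s = Holds c s × Holds d s
  Holds (not c)   s = ¬ Holds c s

  data Outcome : Set where
    done : State → Outcome
    fail : Outcome

  -- Executions that block or diverge have no outcome; in particular no
  -- outcome is derivable from a false assumption.
  data ⟨_,_⟩⇓_ : Stmt S v → State → Outcome → Set where
    skip        : ∀ {s} → ⟨ skip , s ⟩⇓ done s
    copy        : ∀ {x y s} → ⟨ x ≔ y , s ⟩⇓ done (s [ x ]≔ lookup s y)
    call        : ∀ {x f zs s} →
                  ⟨ x ≔ f ⟨ zs ⟩ , s ⟩⇓ done (s [ x ]≔ interp M f (map (lookup s) zs))
    assume      : ∀ {c s} → Holds c s → ⟨ assume c , s ⟩⇓ done s
    assert-ok   : ∀ {c s} → Holds c s → ⟨ assert c , s ⟩⇓ done s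
    assert-fail : ∀ {c s} → ¬ Holds c s → ⟨ assert c , s ⟩⇓ fail
    seq         : ∀ {p q s s′ o} → ⟨ p , s ⟩⇓ done s′ → ⟨ q , s′ ⟩⇓ o → ⟨ p ⨾ q , s ⟩⇓ o
    seq-fail    : ∀ {p q s} → ⟨ p , s ⟩⇓ fail → ⟨ p ⨾ q , s ⟩⇓ fail
    if-true     : ∀ {c p q s o} → Holds c s → ⟨ p , s ⟩⇓ o →
                  ⟨ if c then p else q , s ⟩⇓ o
    if-false    : ∀ {c p q s o} → ¬ Holds c s → ⟨ q , s ⟩⇓ o →
                  ⟨ if c then p else q , s ⟩⇓ o
    while-exit  : ∀ {c p s} → ¬ Holds c s → ⟨ while c loop p , s ⟩⇓ done s
    while-step  : ∀ {c p s s′ o} → Holds c s → ⟨ p , s ⟩⇓ done s′ →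
                  ⟨ while c loop p , s′ ⟩⇓ o → ⟨ while c loop p , s ⟩⇓ o
    while-fail  : ∀ {c p s} → Holds c s → ⟨ p , s ⟩⇓ fail →
                  ⟨ while c loop p , s ⟩⇓ fail

module _ {S : Signature} {v : ℕ} where

  ReachesFail : Stmt S v → Set₁
  ReachesFail P = Σ[ M ∈ Model S ] Σ[ s ∈ State M ] ⟨_,_⟩⇓_ M P s fail

  Correct : Stmt S v → Set₁
  Correct P = (M : Model S) (s : State M) → ¬ ⟨_,_⟩⇓_ M P s fail

  LoopFree : Stmt S v → Set
  LoopFree (p ⨾ q)              = LoopFree p × LoopFree q
  LoopFree (if c then p else q) = LoopFree p × LoopFree q
  LoopFree (while c loop p)     = ⊥
  LoopFree _                    = ⊤

  BranchFree : Stmt S v → Set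
  BranchFree (p ⨾ q)              = BranchFree p × BranchFree q
  BranchFree (if c then p else q) = ⊥
  BranchFree (while c loop p)     = BranchFree p
  BranchFree _                    = ⊤

  AtMostUnary : Stmt S v → Set
  AtMostUnary (x ≔ f ⟨ zs ⟩)       = arity S f ≤ 1
  AtMostUnary (p ⨾ q)              = AtMostUnary p × AtMostUnary q
  AtMostUnary (if c then p else q) = AtMostUnary p × AtMostUnary q
  AtMostUnary (while c loop p)     = AtMostUnary p
  AtMostUnary _                    = ⊤

  EveryLoopBody : (Stmt S v → Set) → Stmt S v → Set
  EveryLoopBody Q (p ⨾ q)              = EveryLoopBody Q p × EveryLoopBody Q q
  EveryLoopBody Q (if c then p else q) = EveryLoopBody Q p × EveryLoopBody Q q
  EveryLoopBody Q (while c loop p)     = Q p × EveryLoopBody Q p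
  EveryLoopBody Q _                    = ⊤

  record Admissible (P : Stmt S v) : Set where
    field
      noNestedLoops       : EveryLoopBody LoopFree P
      noBranchesInLoops   : EveryLoopBody BranchFree P
      onlyUnaryInLoops    : EveryLoopBody AtMostUnary P

------------------------------------------------------------------------
-- EUFⁿ formulas

-- V is a type of variables of sort N.
data Lin (V : Set) : Set where
  const : (c : ℤ) → Lin V
  _·_   : (c : ℤ) (x : V) → Lin V
  _⊕_   : (l l′ : Lin V) → Lin V

data Arith (V : Set) : Set where
  lin   : (l : Lin V) → Arith V
  _div_ : (l : Lin V) (d : ℕ) .{{_ : NonZero d}} → Arith V

data Guard (V : Set) : Set where
  _≤ᵍ_ : (e e′ : Arith V) → Guard V
  _∧ᵍ_ : (G H : Guard V) → Guard V
  ¬ᵍ_  : (G : Guard V) → Guard V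

-- u is the number of variables of sort U.  In pow w e t, the nonempty list w
-- is the composition f₁ ∘ ⋯ ∘ fᵣ, and the term is wᵉ(t).
data Term (S : Signature) (u : ℕ) (V : Set) : Set where
  var : (x : Fin u) → Term S u V
  pow : (w : List⁺ (Unary S)) (e : Arith V) (t : Term S u V) → Term S u V
  app : (g : Symbol S) → 2 ≤ arity S g → (ts : Vec (Term S u V) (arity S g)) → Term S u V

-- m free variables of sort N (among them the loop counts) and k bound index
-- variables in scope.
NVar : ℕ → ℕ → Set
NVar m k = Fin m ⊎ Fin k

data Formula (S : Signature) (u m : ℕ) : ℕ → Set where
  _≐_ : ∀ {k} (t t′ : Term S u (NVar m k)) → Formula S u m k
  _∧_ : ∀ {k} (φ ψ : Formula S u m k) → Formula S u m k
  _∨_ : ∀ {k} (φ ψ : Formula S u m k) → Formula S u m k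
  ~_  : ∀ {k} (φ : Formula S u m k) → Formula S u m k
  _⊃_ : ∀ {k} (G : Guard (NVar m k)) (φ : Formula S u m k) → Formula S u m k
  -- ∀i. i < n → φ, where n is free and index zero of φ stands for i.
  ∀<  : ∀ {k} (n : Fin m) (φ : Formula S u m (suc k)) → Formula S u m k

record EUFⁿ (S : Signature) : Set where
  field
    uvars nvars : ℕ
    formula     : Formula S uvars nvars 0

module _ {V : Set} (ν : V → ℕ) where

  ⟦_⟧ˡ : Lin V → ℤ
  ⟦ const c ⟧ˡ = c
  ⟦ c · x   ⟧ˡ = c ℤ.* (ℤ.+ ν x)
  ⟦ l ⊕ l′  ⟧ˡ = ⟦ l ⟧ˡ ℤ.+ ⟦ l′ ⟧ˡ

  ⟦_⟧ᵃ : Arith V → ℤ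
  ⟦ lin l   ⟧ᵃ = ⟦ l ⟧ˡ
  ⟦ l div d ⟧ᵃ = ⟦ l ⟧ˡ /ℕ d

  ⟦_⟧ᵍ : Guard V → Set
  ⟦ e ≤ᵍ e′ ⟧ᵍ = ⟦ e ⟧ᵃ ℤ.≤ ⟦ e′ ⟧ᵃ
  ⟦ G ∧ᵍ H  ⟧ᵍ = ⟦ G ⟧ᵍ × ⟦ H ⟧ᵍ
  ⟦ ¬ᵍ G    ⟧ᵍ = ¬ ⟦ G ⟧ᵍ

module _ {S : Signature} {u : ℕ} {V : Set}
         (M : Model S) (ρ : Vec (Carrier M) u) (ν : V → ℕ) where

  -- The choice of ∣_∣ is immaterial: exponents are required to be
  -- non-negative by WellDefinedᵗ.
  mutual
    ⟦_⟧ᵗ : Term S u V → Carrier M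
    ⟦ var x      ⟧ᵗ = lookup ρ x
    ⟦ pow w e t  ⟧ᵗ = iterate (compose M w) ⟦ t ⟧ᵗ ∣ ⟦_⟧ᵃ ν e ∣
    ⟦ app g _ ts ⟧ᵗ = interp M g ⟦ ts ⟧ᵗˢ

    ⟦_⟧ᵗˢ : ∀ {n} → Vec (Term S u V) n → Vec (Carrier M) n
    ⟦ []     ⟧ᵗˢ = []
    ⟦ t ∷ ts ⟧ᵗˢ = ⟦ t ⟧ᵗ ∷ ⟦ ts ⟧ᵗˢ

module _ {S : Signature} {u : ℕ} {V : Set} (ν : V → ℕ) where

  mutual
    WellDefinedᵗ : Term S u V → Set
    WellDefinedᵗ (var x)      = ⊤
    WellDefinedᵗ (pow w e t)  = 0ℤ ℤ.≤ ⟦_⟧ᵃ ν e × WellDefinedᵗ t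
    WellDefinedᵗ (app g _ ts) = WellDefinedᵗˢ ts

    WellDefinedᵗˢ : ∀ {n} → Vec (Term S u V) n → Set
    WellDefinedᵗˢ []       = ⊤
    WellDefinedᵗˢ (t ∷ ts) = WellDefinedᵗ t × WellDefinedᵗˢ ts

module _ {m : ℕ} (ν : Vec ℕ m) where

  env : ∀ {k} → Vec ℕ k → NVar m k → ℕ
  env ι = [ lookup ν , lookup ι ]′

  -- Every exponent is non-negative, for all values of the bound indices within
  -- their bounds and guards.  A guard protects the subformula under it, as in
  -- ∀i. (i < n ∧ 3 ≤ i) → f^(i-3)(x) = y.
  WellDefined : ∀ {S u k} → Formula S u m k → Vec ℕ k → Set
  WellDefined (t ≐ t′) ι = WellDefinedᵗ (env ι) t × WellDefinedᵗ (env ι) t′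
  WellDefined (φ ∧ ψ)  ι = WellDefined φ ι × WellDefined ψ ι
  WellDefined (φ ∨ ψ)  ι = WellDefined φ ι × WellDefined ψ ι
  WellDefined (~ φ)    ι = WellDefined φ ι
  WellDefined (G ⊃ φ)  ι = ⟦_⟧ᵍ (env ι) G → WellDefined φ ι
  WellDefined (∀< n φ) ι = (i : ℕ) → i < lookup ν n → WellDefined φ (i ∷ ι)

  module _ {S : Signature} {u : ℕ} (M : Model S) (ρ : Vec (Carrier M) u) where

    True : ∀ {k} → Formula S u m k → Vec ℕ k → Set
    True (t ≐ t′) ι = ⟦_⟧ᵗ M ρ (env ι) t ≡ ⟦_⟧ᵗ M ρ (env ι) t′
    True (φ ∧ ψ)  ι = True φ ι × True ψ ι
    True (φ ∨ ψ)  ι = True φ ι ⊎ True ψ ι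
    True (~ φ)    ι = ¬ True φ ι
    True (G ⊃ φ)  ι = ⟦_⟧ᵍ (env ι) G → True φ ι
    True (∀< n φ) ι = (i : ℕ) → i < lookup ν n → True φ (i ∷ ι)

Satisfiable : ∀ {S} → EUFⁿ S → Set₁
Satisfiable {S} Φ =
  Σ[ ν ∈ Vec ℕ nvars ] Σ[ M ∈ Model S ] Σ[ ρ ∈ Vec (Carrier M) uvars ]
    (WellDefined ν formula [] × True ν M ρ formula [])
  where open EUFⁿ Φ

{-# OPTIONS --safe #-}

-- A straight-line loop body with unary functions replaces the content of each
-- register x by w_x(content of b x), where w_x is a word of unary symbols and
-- b a self-map of the finite set of registers.  If b is idempotent, then 1 + n
-- iterations put w_x (w_{b x})ⁿ(content of b x) into x, a term whose exponent is
-- a variable; universal quantification over i < n expresses that the tests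
-- passed in every iteration.  For u registers the power b^(u!) is idempotent, so
-- a loop is equivalent to a bounded number of iterations of its body, or to
-- 1 + n iterations of the u!-th power of its body followed by a bounded number
-- of iterations of the body.  Constants are kept in registers that
-- are never written, because terms have no nullary function symbols.
module Submission where

open import Defs
open import Data.Empty using (⊥)
open import Data.Fin.Base using (Fin; zero; suc; toℕ; splitAt; _↑ˡ_; _↑ʳ_)
open import Data.Fin.Properties using
  (_≟_; pigeonhole; splitAt-↑ˡ; splitAt-↑ʳ; ↑ʳ-injective; suc-injective; toℕ≤pred[n])
import Data.Integer.Base as ℤ
import Data.Integer.Properties as ℤ
open import Data.List.Base using (List; []; _∷_; _++_; concat; foldr; replicate)
open import Data.List.NonEmpty.Base using (_∷_)
open import Data.List.Properties using (++-assoc; foldr-++)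
open import Data.Nat.Base using (ℕ; zero; suc; _+_; _*_; _≤_; _<_; z≤n; s≤s; _!)
open import Data.Nat.Divisibility using (_∣_; divides; ∣-trans; ∣⇒≤; m∣m*n; m≤n⇒m!∣n!)
open import Data.Nat.DivMod using (_/_; _%_; m≡m%n+[m/n]*n; m%n≤n)
open import Data.Nat.GeneralisedArithmetic using (fold; iterate; fold-+)
import Data.Nat.Properties as ℕ
open import Data.Product.Base using (Σ-syntax; _×_; _,_; proj₁; proj₂)
open import Data.Product.Function.NonDependent.Propositional using (_×-⇔_)
open import Data.Sum.Base using (_⊎_; inj₁; inj₂; [_,_]′)
open import Data.Sum.Function.Propositional using (_⊎-⇔_)
open import Data.Unit.Base using (⊤; tt)
open import Data.Vec.Base using (Vec; []; _∷_; lookup; map; cast; head; tabulate; _[_]≔_)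
  renaming (_++_ to _++ᵛ_)
open import Data.Vec.Functional using (updateAt)
open import Data.Vec.Functional.Properties using (updateAt-updates; updateAt-minimal)
open import Data.Vec.Properties using
  (lookup∘update; lookup∘update′; lookup∘tabulate; lookup-++ˡ; lookup-++ʳ; map-cong; map-∘)
open import Function.Base using (_∘_; id)
open import Function.Bundles using (_⇔_; mk⇔; Equivalence)
open import Function.Related.TypeIsomorphisms using (¬-cong-⇔)
open import Relation.Binary.PropositionalEquality using
  (_≡_; _≢_; _≗_; refl; sym; trans; cong; cong₂; subst; module ≡-Reasoning)
open import Relation.Nullary.Decidable.Core using (yes; no)
open import Relation.Nullary.Negation.Core using (¬_; contradiction)

open Equivalence using (to; from)

private variable
  S : Signature
  u v n : ℕ
  A B : Set

-- Idempotent powers of self-maps of finite sets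

fold-*-fixed : ∀ (f : A → A) d {a} → fold a f d ≡ a → ∀ k → fold a f (k * d) ≡ a
fold-*-fixed f d eq zero    = refl
fold-*-fixed f d {a} eq (suc k) = begin
  fold a f (d + k * d)        ≡⟨ fold-+ a f d ⟩
  fold (fold a f (k * d)) f d ≡⟨ cong (λ b → fold b f d) (fold-*-fixed f d eq k) ⟩
  fold a f d                  ≡⟨ eq ⟩
  a                           ∎
  where open ≡-Reasoning

fold-comm : ∀ (f : A → A) a m n → fold (fold a f m) f n ≡ fold (fold a f n) f m
fold-comm f a m n = begin
  fold (fold a f m) f n ≡⟨ fold-+ a f n ⟨
  fold a f (n + m)      ≡⟨ cong (fold a f) (ℕ.+-comm n m) ⟩
  fold a f (m + n)      ≡⟨ fold-+ a f m ⟩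
  fold (fold a f n) f m ∎
  where open ≡-Reasoning

suc∣! : ∀ {d n} → suc d ≤ n → suc d ∣ n !
suc∣! {d} d<n = ∣-trans (m∣m*n (d !)) (m≤n⇒m!∣n! d<n)

n≤n! : ∀ n → n ≤ n !
n≤n! zero    = z≤n
n≤n! (suc n) = ∣⇒≤ {{suc n ℕ.!≢0}} (suc∣! ℕ.≤-refl)

-- Two of the `u + 1` iterates of `x` with exponents 0 to `u` coincide, so from exponent `i` on the
-- orbit is periodic, with a period at most `u`, which divides `u !`. Since `i ≤ u ≤ u !`, the point
-- reached after `u !` steps lies on the cycle, and `u !` more steps return to it.
fold-!-idempotent : ∀ (f : Fin u → Fin u) x →
                    fold (fold x f (u !)) f (u !) ≡ fold x f (u !)
fold-!-idempotent {u} f x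
  with i , j , i<j , eq ← pigeonhole (ℕ.n<1+n u) (fold x f ∘ toℕ)
  -- The period, the difference of `j` and `i`, is `suc d`.
  with d , 1+i+d≡j ← ℕ.m≤n⇒∃[o]m+o≡n i<j
  with r , i+r≡u! ← ℕ.m≤n⇒∃[o]m+o≡n (ℕ.≤-trans (toℕ≤pred[n] i) (n≤n! u))
  with divides k u!≡k*1+d ← suc∣! (ℕ.≤-trans (ℕ.m≤n+m (suc d) (toℕ i))
         (ℕ.≤-trans (ℕ.≤-reflexive (trans (ℕ.+-suc (toℕ i) d) 1+i+d≡j)) (toℕ≤pred[n] j)))
  = begin
  fold (fold x f (u !)) f (u !) ≡⟨ cong (λ b → fold b f (u !)) reach-a ⟩
  fold (fold a f r) f (u !)     ≡⟨ fold-comm f a r (u !) ⟩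
  fold (fold a f (u !)) f r     ≡⟨ cong (λ b → fold b f r) cycle ⟩
  fold a f r                    ≡⟨ reach-a ⟨
  fold x f (u !)                ∎
  where
  open ≡-Reasoning
  a = fold x f (toℕ i)

  reach-a : fold x f (u !) ≡ fold a f r
  reach-a = trans (cong (fold x f) (trans (sym i+r≡u!) (ℕ.+-comm (toℕ i) r))) (fold-+ x f r)

  period : fold a f (suc d) ≡ a
  period = begin
    fold a f (suc d)         ≡⟨ fold-+ x f (suc d) ⟨
    fold x f (suc d + toℕ i) ≡⟨ cong (fold x f ∘ suc) (ℕ.+-comm d (toℕ i)) ⟩
    fold x f (suc (toℕ i) + d) ≡⟨ cong (fold x f) 1+i+d≡j ⟩
    fold x f (toℕ j)         ≡⟨ eq ⟨
    a                        ∎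

  cycle : fold a f (u !) ≡ a
  cycle = trans (cong (fold a f) u!≡k*1+d) (fold-*-fixed f (suc d) period k)

-- Straight-line blocks

Word : Signature → Set
Word S = List (Unary S)

data Instr (S : Signature) (u : ℕ) : Set where
  move : (x : Fin u) (w : Word S) (y : Fin u) → Instr S u
  test : (c : Cond u) → Instr S u

Block : Signature → ℕ → Set
Block S u = List (Instr S u)

power : ℕ → Block S u → Block S u
power n B = concat (replicate n B)

power-+ : ∀ m n (B : Block S u) → power (m + n) B ≡ power m B ++ power n B
power-+ zero    n B = refl
power-+ (suc m) n B = trans (cong (B ++_) (power-+ m n B)) (sym (++-assoc B _ _))

power-* : ∀ m n (B : Block S u) → power (m * n) B ≡ power m (power n B)
power-* zero    n B = refl
power-* (suc m) n B = trans (power-+ n (m * n) B) (cong (power n B ++_) (power-* m n B))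

-- Registers hold model elements, terms, or formal pairs of a word and a register; one traversal of
-- a block over an arbitrary action serves all three.
Action : Signature → Set → Set
Action S A = Word S → A → A

post : Action S A → Block S u → (Fin u → A) → Fin u → A
post _◃_ []               e = e
post _◃_ (move x w y ∷ B) e = post _◃_ B (updateAt e x (λ _ → w ◃ e y))
post _◃_ (test c ∷ B)     e = post _◃_ B e

post-++ : ∀ (_◃_ : Action S A) B C (e : Fin u → A) →
          post _◃_ (B ++ C) e ≡ post _◃_ C (post _◃_ B e)
post-++ _◃_ []               C e = refl
post-++ _◃_ (move x w y ∷ B) C e = post-++ _◃_ B C _
post-++ _◃_ (test c ∷ B)     C e = post-++ _◃_ B C e

module _ (R : A → B → Set) where

  updateAt-rel : ∀ {d : Fin u → A} {e : Fin u → B} {a b} → (∀ y → R (d y) (e y)) → R a b →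
                 ∀ x y → R (updateAt d x (λ _ → a) y) (updateAt e x (λ _ → b) y)
  updateAt-rel r p zero    zero    = p
  updateAt-rel r p zero    (suc y) = r (suc y)
  updateAt-rel r p (suc x) zero    = r zero
  updateAt-rel r p (suc x) (suc y) = updateAt-rel (r ∘ suc) p x y

  -- Used twice: to derive the effect of a block from its summary, and to show that symbolic
  -- execution on terms follows execution on values.
  post-rel : ∀ {_◃₁_ : Action S A} {_◃₂_ : Action S B} →
             (∀ w {a b} → R a b → R (w ◃₁ a) (w ◃₂ b)) →
             ∀ C {d : Fin u → A} {e : Fin u → B} → (∀ y → R (d y) (e y)) →
             ∀ y → R (post _◃₁_ C d y) (post _◃₂_ C e y)
  post-rel h []               r = r
  post-rel h (move x w y ∷ C) r = post-rel h C (updateAt-rel r (h w (r y)) x)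
  post-rel h (test c ∷ C)     r = post-rel h C r

-- The free action. Started with every register holding itself under the empty word, a block records
-- its whole effect on the registers.
free : Action S (Word S × Fin u)
free w (w′ , x) = w ++ w′ , x

summary : Block S u → Fin u → Word S × Fin u
summary B = post free B ([] ,_)

word : Block S u → Fin u → Word S
word B = proj₁ ∘ summary B

base : Block S u → Fin u → Fin u
base B = proj₂ ∘ summary B

-- A pair `(w , y)` denotes `w ◃ e y`. By the action laws this denotation commutes with prefixing a
-- word, so `post-rel` transfers the free run to any other.
post-summary : ∀ {_◃_ : Action S A} → (∀ a → [] ◃ a ≡ a) →
               (∀ w w′ a → (w ++ w′) ◃ a ≡ w ◃ (w′ ◃ a)) →
               ∀ B (e : Fin u → A) x → post _◃_ B e x ≡ word B x ◃ e (base B x)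
post-summary {_◃_ = _◃_} ◃-[] ◃-++ B e x =
  sym (post-rel (λ p a → proj₁ p ◃ e (proj₂ p) ≡ a)
        (λ { w {w′ , y} refl → ◃-++ w w′ (e y) }) B (λ y → ◃-[] (e y)) x)

-- `base` traces contents backwards in time, hence through `C` first. The free action satisfies the
-- action laws, so `post-summary` for `C` applies to the summary of `B`.
base-++ : ∀ (B C : Block S u) x → base (B ++ C) x ≡ base B (base C x)
base-++ B C x = cong proj₂ (begin
  summary (B ++ C) x                       ≡⟨ cong (λ e → e x) (post-++ free B C _) ⟩
  post free C (summary B) x                ≡⟨ post-summary (λ _ → refl)
                                                (λ w w′ p → cong (_, proj₂ p) (++-assoc w w′ (proj₁ p)))
                                                C (summary B) x ⟩
  free (word C x) (summary B (base C x)) ∎)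
  where open ≡-Reasoning

base-power : ∀ n (B : Block S u) x → base (power n B) x ≡ fold x (base B) n
base-power zero    B x = refl
base-power (suc n) B x = trans (base-++ B (power n B) x) (cong (base B) (base-power n B x))

Idempotent : Block S u → Set
Idempotent B = ∀ x → base B (base B x) ≡ base B x

power-!-idempotent : ∀ (B : Block S u) → Idempotent (power (u !) B)
power-!-idempotent {u = u} B x
  rewrite base-power (u !) B (base (power (u !) B) x) | base-power (u !) B x
  = fold-!-idempotent (base B) x

-- Tests and iterated blocks

Sat : Cond u → (Fin u → A) → Set
Sat (x == y)  e = e x ≡ e y
Sat (c and d) e = Sat c e × Sat d e
Sat (not c)   e = ¬ Sat c e

Pass : Action S A → Block S u → (Fin u → A) → Set
Pass _◃_ []               e = ⊤
Pass _◃_ (move x w y ∷ B) e = Pass _◃_ B (updateAt e x (λ _ → w ◃ e y))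
Pass _◃_ (test c ∷ B)     e = Sat c e × Pass _◃_ B e

pass-++ : ∀ (_◃_ : Action S A) B C (e : Fin u → A) →
          Pass _◃_ (B ++ C) e ⇔ (Pass _◃_ B e × Pass _◃_ C (post _◃_ B e))
pass-++ _◃_ []               C e = mk⇔ (tt ,_) proj₂
pass-++ _◃_ (move x w y ∷ B) C e = pass-++ _◃_ B C _
pass-++ _◃_ (test c ∷ B)     C e = mk⇔
  (λ (h , p) → let q , r = to (pass-++ _◃_ B C e) p in (h , q) , r)
  (λ ((h , q) , r) → h , from (pass-++ _◃_ B C e) (q , r))

-- Puts the tests of an iterated block into the form that a quantifier over a bounded index can
-- express.
pass-power : ∀ (_◃_ : Action S A) (B : Block S u) n e →
             Pass _◃_ (power n B) e ⇔ (∀ i → i < n → Pass _◃_ B (post _◃_ (power i B) e))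
pass-power _◃_ B zero    e = mk⇔ (λ _ i ()) (λ _ → tt)
pass-power _◃_ B (suc n) e = mk⇔ split join
  where
  split : _ → _
  split p zero    _         = proj₁ (to (pass-++ _◃_ B (power n B) e) p)
  split p (suc i) (s≤s i<n) = subst (Pass _◃_ B) (sym (post-++ _◃_ B (power i B) e))
    (to (pass-power _◃_ B n _) (proj₂ (to (pass-++ _◃_ B (power n B) e) p)) i i<n)

  join : _ → _
  join h = from (pass-++ _◃_ B (power n B) e)
    ( h 0 (s≤s z≤n)
    , from (pass-power _◃_ B n _)
        (λ i i<n → subst (Pass _◃_ B) (post-++ _◃_ B (power i B) e) (h (suc i) (s≤s i<n))))

wordAct : (M : Model S) → Action S (Carrier M)
wordAct M w a = foldr (apply₁ M) a w

-- By idempotence the register `base B x` is its own base, so each iteration applies the same word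
-- to its content; `x` fetches the result in the last iteration.
post-power : ∀ (M : Model S) (B : Block S u) → Idempotent B → ∀ n e x →
             post (wordAct M) (power (suc n) B) e x ≡
             wordAct M (word B x) (iterate (wordAct M (word B (base B x))) (e (base B x)) n)
post-power M B idem zero e x
  rewrite post-++ (wordAct M) B [] e
  = post-summary (λ _ → refl) (λ w w′ a → foldr-++ (apply₁ M) a w w′) B e x
post-power M B idem (suc n) e x = begin
  post (wordAct M) (B ++ power (suc n) B) e x
    ≡⟨ cong (λ e → e x) (post-++ (wordAct M) B (power (suc n) B) e) ⟩
  post (wordAct M) (power (suc n) B) (post (wordAct M) B e) x
    ≡⟨ post-power M B idem n _ x ⟩
  outer (post (wordAct M) B e (base B x))
    ≡⟨ cong outer (post-summary (λ _ → refl) (λ w w′ a → foldr-++ (apply₁ M) a w w′) B e (base B x)) ⟩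
  outer (inner (e (base B (base B x))))
    ≡⟨ cong (λ y → outer (inner (e y))) (idem x) ⟩
  -- `iterate` applies the function to its start value first, so the application of `inner` is
  -- absorbed definitionally into the count `suc n`.
  outer (inner (e (base B x)))
    ∎
  where
  open ≡-Reasoning
  inner = wordAct M (word B (base B x))
  outer : Carrier M → Carrier M
  outer a = wordAct M (word B x) (iterate inner a n)

-- Programs as trees of register instructions

-- A run is a path to `reach`, which stands for Fail. Blocks contain only unary words, so symbols of
-- arity at least 2 have their own node. `plus` demands idempotence so that its iterations can be
-- described by terms with a variable exponent.
data Tree (S : Signature) (u : ℕ) : Set where
  dead reach : Tree S u
  seq        : (B : Block S u) (κ : Tree S u) → Tree S u
  call       : (x : Fin u) (g : Symbol S) → 2 ≤ arity S g → (zs : Vec (Fin u) (arity S g))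
               (κ : Tree S u) → Tree S u
  choice     : (s t : Tree S u) → Tree S u
  plus       : (B : Block S u) → Idempotent B → (κ : Tree S u) → Tree S u

module _ (M : Model S) where

  Run : Tree S u → (Fin u → Carrier M) → Set
  Run dead              e = ⊥
  Run reach             e = ⊤
  Run (seq B κ)         e = Pass (wordAct M) B e × Run κ (post (wordAct M) B e)
  Run (call x g _ zs κ) e = Run κ (updateAt e x (λ _ → interp M g (map e zs)))
  Run (choice s t)      e = Run s e ⊎ Run t e
  Run (plus B _ κ)      e =
    Σ[ n ∈ ℕ ] Pass (wordAct M) (power (suc n) B) e × Run κ (post (wordAct M) (power (suc n) B) e)

  run-++ : ∀ (B C : Block S u) κ e → Run (seq (B ++ C) κ) e ⇔ Run (seq B (seq C κ)) e
  run-++ B C κ e rewrite post-++ (wordAct M) B C e = mk⇔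
    (λ (p , r) → let q , q′ = to (pass-++ (wordAct M) B C e) p in q , q′ , r)
    (λ (q , q′ , r) → from (pass-++ (wordAct M) B C e) (q , q′) , r)

atMost : ℕ → Block S u → Tree S u → Tree S u
atMost zero    B κ = κ
atMost (suc n) B κ = choice κ (seq B (atMost n B κ))

star : Block S u → Tree S u → Tree S u
star {u = u} B κ = choice (atMost (u !) B κ) (plus (power (u !) B) (power-!-idempotent B) (atMost (u !) B κ))

module _ (M : Model S) where

  atMost-intro : ∀ {m n} → m ≤ n → ∀ (B : Block S u) κ {e} →
                 Run M (seq (power m B) κ) e → Run M (atMost n B κ) e
  atMost-intro {n = zero}  z≤n       B κ (_ , r) = r
  atMost-intro {n = suc n} z≤n       B κ (_ , r) = inj₁ r
  atMost-intro {m = suc m} (s≤s m≤n) B κ {e} r   =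
    let q , r′ = to (run-++ M B (power m B) κ e) r in inj₂ (q , atMost-intro m≤n B κ r′)

  atMost-elim : ∀ n (B : Block S u) κ {e} → Run M (atMost n B κ) e →
                Σ[ m ∈ ℕ ] Run M (seq (power m B) κ) e
  atMost-elim zero    B κ r              = 0 , tt , r
  atMost-elim (suc n) B κ (inj₁ r)       = 0 , tt , r
  atMost-elim (suc n) B κ {e} (inj₂ (q , r)) =
    let m , r′ = atMost-elim n B κ r in suc m , from (run-++ M B (power m B) κ e) (q , r′)

  star-intro : ∀ n (B : Block S u) κ {e} → Run M (seq (power n B) κ) e → Run M (star B κ) e
  star-intro {u = u} n B κ {e} r
    = go (n / (u !)) (subst (λ k → Run M (seq (power k B) κ) e) n≡ r)
    where
    instance _ = u ℕ.!≢0
    ρ = n % (u !)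

    n≡ : n ≡ n / (u !) * (u !) + ρ
    n≡ = trans (m≡m%n+[m/n]*n n (u !)) (ℕ.+-comm ρ _)

    -- Admitting `u !` itself as a remainder is harmless, since every count is a legitimate number
    -- of iterations.
    rest : ∀ {e} → Run M (seq (power ρ B) κ) e → Run M (atMost (u !) B κ) e
    rest = atMost-intro (m%n≤n n (u !)) B κ

    go : ∀ k → Run M (seq (power (k * (u !) + ρ) B) κ) e → Run M (star B κ) e
    go zero    r = inj₁ (rest r)
    go (suc k) r rewrite power-+ (suc k * (u !)) ρ B | power-* (suc k) (u !) B =
      let q , r′ = to (run-++ M (power (suc k) (power (u !) B)) (power ρ B) κ e) r
      -- `plus` runs the power `suc k` times for the count `k`; quotient zero is the other branch of
      -- `star`.
      in inj₂ (k , q , rest r′)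

  star-elim : ∀ (B : Block S u) κ {e} → Run M (star B κ) e →
              Σ[ n ∈ ℕ ] Run M (seq (power n B) κ) e
  star-elim {u = u} B κ     (inj₁ r)           = atMost-elim (u !) B κ r
  star-elim {u = u} B κ {e} (inj₂ (k , q , r)) with m , r′ ← atMost-elim (u !) B κ r =
    suc k * (u !) + m , subst (λ C → Run M (seq C κ) e)
      (sym (trans (power-+ (suc k * (u !)) m B) (cong (_++ power m B) (power-* (suc k) (u !) B))))
      (from (run-++ M (power (suc k) (power (u !) B)) (power m B) κ e) (q , r′))

-- Explicit loop counts

-- Free variables of sort N are chosen before the run, so every `plus` node gets one, also on
-- branches that the run does not take.
loops : Tree S u → ℕ
loops dead              = 0
loops reach             = 0
loops (seq B κ)         = loops κ
loops (call x g _ zs κ) = loops κ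
loops (choice s t)      = loops s + loops t
loops (plus B _ κ)      = suc (loops κ)

module _ (M : Model S) where

  RunAt : (t : Tree S u) → (Fin (loops t) → ℕ) → (Fin u → Carrier M) → Set
  RunAt dead              c e = ⊥
  RunAt reach             c e = ⊤
  RunAt (seq B κ)         c e = Pass (wordAct M) B e × RunAt κ c (post (wordAct M) B e)
  RunAt (call x g _ zs κ) c e = RunAt κ c (updateAt e x (λ _ → interp M g (map e zs)))
  RunAt (choice s t)      c e = RunAt s (c ∘ (_↑ˡ loops t)) e ⊎ RunAt t (c ∘ (loops s ↑ʳ_)) e
  RunAt (plus B _ κ)      c e =
    Pass (wordAct M) (power (suc (c zero)) B) e ×
    RunAt κ (c ∘ suc) (post (wordAct M) (power (suc (c zero)) B) e)

  runAt⇒run : ∀ (t : Tree S u) {c e} → RunAt t c e → Run M t e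
  runAt⇒run reach             r        = tt
  runAt⇒run (seq B κ)         (p , r)  = p , runAt⇒run κ r
  runAt⇒run (call x g _ zs κ) r        = runAt⇒run κ r
  runAt⇒run (choice s t)      (inj₁ r) = inj₁ (runAt⇒run s r)
  runAt⇒run (choice s t)      (inj₂ r) = inj₂ (runAt⇒run t r)
  runAt⇒run (plus B _ κ) {c}  (p , r)  = c zero , p , runAt⇒run κ r

  -- The counts will be stored in a vector, and looking them up gives back the function `c` only
  -- pointwise; hence the quantification over `c′`.
  run⇒runAt : ∀ (t : Tree S u) {e} → Run M t e →
              Σ[ c ∈ (Fin (loops t) → ℕ) ] (∀ c′ → c′ ≗ c → RunAt t c′ e)
  run⇒runAt reach             r       = (λ ()) , λ _ _ → tt
  run⇒runAt (seq B κ)         (p , r) = let c , h = run⇒runAt κ r in c , λ c′ eq → p , h c′ eq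
  run⇒runAt (call x g _ zs κ) r       = run⇒runAt κ r
  run⇒runAt (choice s t)     (inj₁ r) = let c , h = run⇒runAt s r in
    -- Loops on the branch not taken get count 0.
    [ c , (λ _ → 0) ]′ ∘ splitAt (loops s) ,
    λ c′ eq → inj₁ (h _ λ i →
      trans (eq (i ↑ˡ loops t)) (cong [ c , (λ _ → 0) ]′ (splitAt-↑ˡ (loops s) i (loops t))))
  run⇒runAt (choice s t)     (inj₂ r) = let c , h = run⇒runAt t r in
    [ (λ _ → 0) , c ]′ ∘ splitAt (loops s) ,
    λ c′ eq → inj₂ (h _ λ i →
      trans (eq (loops s ↑ʳ i)) (cong [ (λ _ → 0) , c ]′ (splitAt-↑ʳ (loops s) (loops t) i)))
  run⇒runAt (plus B _ κ) {e} (n , p , r) = let c , h = run⇒runAt κ r in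
    (λ { zero → n ; (suc i) → c i }) ,
    λ c′ eq → subst (λ k → Pass (wordAct M) (power (suc k) B) e ×
                           RunAt κ (c′ ∘ suc) (post (wordAct M) (power (suc k) B) e))
                (sym (eq zero)) (p , h _ (eq ∘ suc))

-- From trees to formulas

private variable
  m k : ℕ
  V : Set

-- `pow` takes a nonempty composition only; all powers of the empty word are the identity.
pow′ : Word S → Arith V → Term S u V → Term S u V
pow′ []      a t = t
pow′ (f ∷ w) a t = pow (f ∷ w) a t

termAct : Action S (Term S u V)
termAct w = pow′ w (lin (const ℤ.1ℤ))

-- The contents of the registers after 1 + x iterations of B.
after : Block S u → V → (Fin u → Term S n V) → Fin u → Term S n V
after B x τ y = termAct (word B y)
  (pow′ (word B (base B y)) (lin (ℤ.1ℤ · x)) (τ (base B y)))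

-- Register zero is never written; it is there because every formula contains a
-- term, so that even truth needs a variable of sort U.
⊤ᶠ : Formula S (suc u) m k
⊤ᶠ = var zero ≐ var zero

satᶠ : Cond u → (Fin u → Term S n (NVar m k)) → Formula S n m k
satᶠ (x == y)  τ = τ x ≐ τ y
satᶠ (c and d) τ = satᶠ c τ ∧ satᶠ d τ
satᶠ (not c)   τ = ~ satᶠ c τ

passᶠ : Block S u → (Fin u → Term S (suc n) (NVar m k)) → Formula S (suc n) m k
passᶠ []               τ = ⊤ᶠ
passᶠ (move x w y ∷ B) τ = passᶠ B (updateAt τ x (λ _ → termAct w (τ y)))
passᶠ (test c ∷ B)     τ = satᶠ c τ ∧ passᶠ B τ

-- σ assigns to each loop of the tree the variable that holds its count.  The
-- symbolic state τ is given at every depth k so that it can also be used in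
-- the scope of a bound index.
runᶠ : (t : Tree S u) (σ : Fin (loops t) → Fin m) (τ : ∀ k → Fin u → Term S (suc n) (NVar m k)) →
       Formula S (suc n) m 0
runᶠ dead                σ τ = ~ ⊤ᶠ
runᶠ reach               σ τ = ⊤ᶠ
runᶠ (seq B κ)           σ τ = passᶠ B (τ 0) ∧ runᶠ κ σ (λ k → post termAct B (τ k))
runᶠ (call x g 2≤g zs κ) σ τ = runᶠ κ σ (λ k → updateAt (τ k) x (λ _ → app g 2≤g (map (τ k) zs)))
runᶠ (choice s t)        σ τ = runᶠ s (σ ∘ (_↑ˡ loops t)) τ ∨ runᶠ t (σ ∘ (loops s ↑ʳ_)) τ
runᶠ (plus B _ κ)        σ τ =
  (passᶠ B (τ 0) ∧ ∀< (σ zero) (passᶠ B (after B (inj₂ zero) (τ 1)))) ∧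
  runᶠ κ (σ ∘ suc) (λ k → after B (inj₁ (σ zero)) (τ k))

-- Adequacy of the formulas

iterate-cong : ∀ {f g : A → A} → f ≗ g → ∀ a n → iterate f a n ≡ iterate g a n
iterate-cong         f≗g a zero    = refl
iterate-cong {g = g} f≗g a (suc n) rewrite f≗g a = iterate-cong f≗g (g a) n

iterate-id : ∀ (a : A) n → iterate id a n ≡ a
iterate-id a zero    = refl
iterate-id a (suc n) = iterate-id a n

compose-wordAct : ∀ (M : Model S) f w → compose M (f ∷ w) ≗ wordAct M (f ∷ w)
compose-wordAct M f []      a = refl
compose-wordAct M f (g ∷ w) a = cong (apply₁ M f) (compose-wordAct M g w a)

module _ (M : Model S) (ρ : Vec (Carrier M) n) (η : V → ℕ) where

  -- Satisfiability demands non-negative exponents besides truth, so both are carried along the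
  -- symbolic execution.
  record Represents (t : Term S n V) (a : Carrier M) : Set where
    constructor _,_
    field
      wellDefined : WellDefinedᵗ η t
      value       : ⟦_⟧ᵗ M ρ η t ≡ a

  pow′-represents : ∀ w e {j t a} → ⟦_⟧ᵃ η e ≡ ℤ.+ j → Represents t a →
                    Represents (pow′ w e t) (iterate (wordAct M w) a j)
  pow′-represents []      e {j} {a = a} eq (wd , refl) = wd , sym (iterate-id a j)
  pow′-represents (f ∷ w) e {j} {a = a} eq (wd , refl) =
    (subst (ℤ.0ℤ ℤ.≤_) (sym eq) (ℤ.+≤+ z≤n) , wd) ,
    trans (cong (iterate _ a ∘ ℤ.∣_∣) eq) (iterate-cong (compose-wordAct M f w) a j)

  termAct-represents : ∀ w {t a} → Represents t a → Represents (termAct w t) (wordAct M w a)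
  termAct-represents w = pow′-represents w (lin (const ℤ.1ℤ)) refl

  map-represents : ∀ {τ : Fin u → Term S n V} {e} → (∀ y → Represents (τ y) (e y)) →
                   ∀ {l} (zs : Vec (Fin u) l) →
                   WellDefinedᵗˢ η (map τ zs) × ⟦_⟧ᵗˢ M ρ η (map τ zs) ≡ map e zs
  map-represents r []       = tt , refl
  map-represents r (z ∷ zs) =
    let wd , eq = r z ; wds , eqs = map-represents r zs in (wd , wds) , cong₂ _∷_ eq eqs

  -- The symbolic form of `post-power`: the count becomes the exponent.
  after-represents : ∀ (B : Block S u) → Idempotent B → ∀ x {τ e} →
                     (∀ y → Represents (τ y) (e y)) →
                     ∀ y → Represents (after B x τ y) (post (wordAct M) (power (suc (η x)) B) e y)
  after-represents B idem x {τ} {e} r y =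
    subst (Represents (after B x τ y)) (sym (post-power M B idem (η x) e y))
      (termAct-represents (word B y)
        (pow′-represents (word B (base B y)) (lin (ℤ.1ℤ · x)) (ℤ.*-identityˡ _) (r (base B y))))

module _ (M : Model S) (ρ : Vec (Carrier M) (suc n)) (ν : Vec ℕ m) where

  -- Well-definedness can be shown without assuming truth, because the only exponents produced are 1
  -- and single variables.
  record Adequate (ι : Vec ℕ k) (φ : Formula S (suc n) m k) (X : Set) : Set where
    constructor _,_
    field
      wellDefined : WellDefined ν φ ι
      equivalent  : True ν M ρ φ ι ⇔ X

  open Adequate

  ∧-adequate : ∀ {ι : Vec ℕ k} {φ ψ X Y} →
               Adequate ι φ X → Adequate ι ψ Y → Adequate ι (φ ∧ ψ) (X × Y)
  ∧-adequate (wd , eq) (wd′ , eq′) = (wd , wd′) , (eq ×-⇔ eq′)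

  ⊤ᶠ-adequate : ∀ {ι : Vec ℕ k} → Adequate ι ⊤ᶠ ⊤
  ⊤ᶠ-adequate = (tt , tt) , mk⇔ (λ _ → tt) (λ _ → refl)

  module _ (ι : Vec ℕ k) where

    private
      _~ʳ_ : (Fin u → Term S (suc n) (NVar m k)) → (Fin u → Carrier M) → Set
      τ ~ʳ e = ∀ y → Represents M ρ (env ν ι) (τ y) (e y)

    satᶠ-adequate : ∀ (c : Cond u) {τ e} → τ ~ʳ e → Adequate ι (satᶠ c τ) (Sat c e)
    satᶠ-adequate (x == y) r with wd , eq ← r x | wd′ , eq′ ← r y =
      (wd , wd′) , mk⇔ (λ p → trans (sym eq) (trans p eq′)) (λ p → trans eq (trans p (sym eq′)))
    satᶠ-adequate (c and d) r = ∧-adequate (satᶠ-adequate c r) (satᶠ-adequate d r)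
    satᶠ-adequate (not c)   r = let wd , eq = satᶠ-adequate c r in wd , ¬-cong-⇔ eq

    passᶠ-adequate : ∀ (B : Block S u) {τ e} → τ ~ʳ e →
                     Adequate ι (passᶠ B τ) (Pass (wordAct M) B e)
    passᶠ-adequate []               r = ⊤ᶠ-adequate
    passᶠ-adequate (move x w y ∷ B) r = passᶠ-adequate B
      (updateAt-rel (Represents M ρ (env ν ι)) r (termAct-represents M ρ (env ν ι) w (r y)) x)
    passᶠ-adequate (test c ∷ B)     r = ∧-adequate (satᶠ-adequate c r) (passᶠ-adequate B r)

  -- `after` describes states after at least one iteration. So iteration 0 is tested separately, and
  -- the bound index `i` stands for iteration `suc i`.
  passᶠ-plus-adequate : ∀ (B : Block S u) → Idempotent B → ∀ x {τ : ∀ k → Fin u → Term S (suc n) (NVar m k)} {e} →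
    (∀ {k} (ι : Vec ℕ k) y → Represents M ρ (env ν ι) (τ k y) (e y)) →
    Adequate [] (passᶠ B (τ 0) ∧ ∀< x (passᶠ B (after B (inj₂ zero) (τ 1))))
      (Pass (wordAct M) (power (suc (lookup ν x)) B) e)
  passᶠ-plus-adequate B idem x {τ} {e} r =
    (wellDefined first , λ i _ → wellDefined (later i)) , mk⇔
      (λ (p , q) → from unfold
        λ { zero _ → to (equivalent first) p ; (suc i) (s≤s i<n) → to (equivalent (later i)) (q i i<n) })
      (λ p → from (equivalent first) (to unfold p 0 (s≤s z≤n)) ,
             λ i i<n → from (equivalent (later i)) (to unfold p (suc i) (s≤s i<n)))
    where
    unfold = pass-power (wordAct M) B (suc (lookup ν x)) e
    first  = passᶠ-adequate [] B {τ 0} {e} (r [])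
    later  = λ i → passᶠ-adequate (i ∷ []) B
      (after-represents M ρ (env ν (i ∷ [])) B idem (inj₂ zero) (r (i ∷ [])))

  runᶠ-adequate : ∀ (t : Tree S u) {σ τ e} →
    (∀ {k} (ι : Vec ℕ k) y → Represents M ρ (env ν ι) (τ k y) (e y)) →
    Adequate [] (runᶠ t σ τ) (RunAt M t (lookup ν ∘ σ) e)
  runᶠ-adequate dead              r = (tt , tt) , mk⇔ (λ h → h refl) (λ ())
  runᶠ-adequate reach             r = ⊤ᶠ-adequate
  runᶠ-adequate (seq B κ)         r = ∧-adequate (passᶠ-adequate [] B (r []))
    (runᶠ-adequate κ λ ι →
      post-rel (Represents M ρ (env ν ι)) (termAct-represents M ρ (env ν ι)) B (r ι))
  runᶠ-adequate (call x g 2≤g zs κ) r = runᶠ-adequate κ λ ι →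
    updateAt-rel (Represents M ρ (env ν ι)) (r ι)
      (let wd , eq = map-represents M ρ (env ν ι) (r ι) zs in wd , cong (interp M g) eq) x
  runᶠ-adequate (choice s t)      r =
    let wd , eq = runᶠ-adequate s r ; wd′ , eq′ = runᶠ-adequate t r in (wd , wd′) , (eq ⊎-⇔ eq′)
  runᶠ-adequate (plus B idem κ) {σ} r = ∧-adequate (passᶠ-plus-adequate B idem (σ zero) r)
    (runᶠ-adequate κ λ ι → after-represents M ρ (env ν ι) B idem (inj₁ (σ zero)) (r ι))

-- Compilation of programs

-- Reserving a register for every symbol, after register zero and before the program variables,
-- spares counting the constants.
registers : Signature → ℕ → ℕ
registers S v = suc (symbols S + v)

module Registers (S : Signature) (v : ℕ) where

  constReg : Symbol S → Fin (registers S v)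
  constReg f = suc (f ↑ˡ v)

  varReg : Fin v → Fin (registers S v)
  varReg x = suc (symbols S ↑ʳ x)

  varReg-injective : ∀ {x y} → varReg x ≡ varReg y → x ≡ y
  varReg-injective = ↑ʳ-injective (symbols S) _ _ ∘ suc-injective

  constReg≢varReg : ∀ {f x} → constReg f ≢ varReg x
  constReg≢varReg {f} {x} eq
    with () ← trans (sym (splitAt-↑ˡ (symbols S) f v))
                (trans (cong (splitAt (symbols S)) (suc-injective eq)) (splitAt-↑ʳ (symbols S) v x))

  condReg : Cond v → Cond (registers S v)
  condReg (x == y)  = varReg x == varReg y
  condReg (c and d) = condReg c and condReg d
  condReg (not c)   = not condReg c

data ArityView (n : ℕ) : Set where
  nullary : n ≡ 0 → ArityView n
  unary   : n ≡ 1 → ArityView n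
  multi   : 2 ≤ n → ArityView n

arityView : ∀ n → ArityView n
arityView 0             = nullary refl
arityView 1             = unary refl
arityView (suc (suc n)) = multi (s≤s (s≤s z≤n))

module _ {S : Signature} {v : ℕ} where

  open Registers S v

  callBlock : (x : Fin v) (f : Symbol S) → Vec (Fin v) (arity S f) → ArityView (arity S f) →
              Block S (registers S v)
  callBlock x f zs (nullary _) = move (varReg x) [] (constReg f) ∷ []
  callBlock x f zs (unary eq)  = move (varReg x) ((f , eq) ∷ []) (varReg (head (cast eq zs))) ∷ []
  callBlock x f zs (multi _)   = []

  -- Only meaningful for loop-free and branch-free statements without functions
  -- of arity ≥ 2.
  block : Stmt S v → Block S (registers S v)
  block skip                 = []
  block (x ≔ y)              = move (varReg x) [] (varReg y) ∷ []
  block (x ≔ f ⟨ zs ⟩)       = callBlock x f zs (arityView (arity S f))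
  block (assume c)           = test (condReg c) ∷ []
  -- Blocks describe iterations that end normally; a failing iteration is left to `lastTest`.
  block (assert c)           = test (condReg c) ∷ []
  block (p ⨾ q)              = block p ++ block q
  block (if c then p else q) = []
  block (while c loop p)     = []

  callTree : (x : Fin v) (f : Symbol S) → Vec (Fin v) (arity S f) → ArityView (arity S f) →
             Tree S (registers S v) → Tree S (registers S v)
  callTree x f zs (multi 2≤f) κ = call (varReg x) f 2≤f (map varReg zs) κ
  callTree x f zs view        κ = seq (callBlock x f zs view) κ

  -- compile P κ runs P and, if P does not fail, continues with κ.
  mutual
    compile : Stmt S v → Tree S (registers S v) → Tree S (registers S v)
    compile (x ≔ f ⟨ zs ⟩)       κ = callTree x f zs (arityView (arity S f)) κ
    compile (assert c)           κ =
      -- A violated assertion discards the continuation and ends in `reach`.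
      choice (seq (test (condReg c) ∷ []) κ) (seq (test (not condReg c) ∷ []) reach)
    compile (p ⨾ q)              κ = compile p (compile q κ)
    compile (if c then p else q) κ =
      choice (seq (test (condReg c) ∷ []) (compile p κ))
             (seq (test (not condReg c) ∷ []) (compile q κ))
    compile (while c loop p)     κ = star (test (condReg c) ∷ block p) (lastTest c p κ)
    compile P                    κ = seq (block P) κ

    -- After the completed iterations the loop either exits or enters an iteration that fails. The
    -- continuation `dead` leaves only the failing runs of the body.
    lastTest : Cond v → Stmt S v → Tree S (registers S v) → Tree S (registers S v)
    lastTest c p κ = choice (seq (test (not condReg c) ∷ []) κ)
                            (seq (test (condReg c) ∷ []) (compile p dead))

-- Correctness of the compilation

StraightLine : Stmt S v → Set
StraightLine p = LoopFree p × BranchFree p × AtMostUnary p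

EveryLoopBody-× : ∀ {Q R : Stmt S v → Set} P → EveryLoopBody Q P → EveryLoopBody R P →
                  EveryLoopBody (λ p → Q p × R p) P
EveryLoopBody-× skip                 _ _ = tt
EveryLoopBody-× (x ≔ y)              _ _ = tt
EveryLoopBody-× (x ≔ f ⟨ zs ⟩)       _ _ = tt
EveryLoopBody-× (assume c)           _ _ = tt
EveryLoopBody-× (assert c)           _ _ = tt
EveryLoopBody-× (p ⨾ q)              (h , k) (h′ , k′) = EveryLoopBody-× p h h′ , EveryLoopBody-× q k k′
EveryLoopBody-× (if c then p else q) (h , k) (h′ , k′) = EveryLoopBody-× p h h′ , EveryLoopBody-× q k k′
EveryLoopBody-× (while c loop p)     (h , k) (h′ , k′) = (h , h′) , EveryLoopBody-× p k k′

straightLineBodies : ∀ {P : Stmt S v} → Admissible P → EveryLoopBody StraightLine P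
straightLineBodies {P = P} adm =
  EveryLoopBody-× P noNestedLoops (EveryLoopBody-× P noBranchesInLoops onlyUnaryInLoops)
  where open Admissible adm

cast-[] : ∀ (eq : n ≡ 0) (xs : Vec A n) → cast (sym eq) [] ≡ xs
cast-[] refl [] = refl

cast-[-] : ∀ (eq : n ≡ 1) (g : A → B) xs → cast (sym eq) (g (head (cast eq xs)) ∷ []) ≡ map g xs
cast-[-] refl g (x ∷ []) = refl

-- The program is run under the interpretation I and the tree under J, and they
-- differ on constants only: the value of a constant is that of its register.
module _ {S : Signature} {v : ℕ} {A : Set} (I J : (f : Symbol S) → Vec A (arity S f) → A)
         (I≗J : ∀ f zs → arity S f ≢ 0 → I f zs ≡ J f zs) where

  open Registers S v

  private
    MI MJ : Model S
    MI = record { Carrier = A ; interp = I }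
    MJ = record { Carrier = A ; interp = J }

    Exec : Stmt S v → Vec A v → Outcome {S} {v} MI → Set
    Exec = ⟨_,_⟩⇓_ MI

  record Agree (e : Fin (registers S v) → A) (s : Vec A v) : Set where
    field
      vars   : ∀ x → e (varReg x) ≡ lookup s x
      consts : ∀ f zs → arity S f ≡ 0 → e (constReg f) ≡ I f zs

  open Agree

  agree-update : ∀ {e s x a b} → Agree e s → a ≡ b →
                 Agree (updateAt e (varReg x) (λ _ → a)) (s [ x ]≔ b)
  agree-update {e} {s} {x} {a} agr refl .vars y with y ≟ x
  ... | yes refl = trans (updateAt-updates (varReg x) e) (sym (lookup∘update x s a))
  ... | no  y≢x  = trans (updateAt-minimal (varReg y) (varReg x) e (y≢x ∘ varReg-injective))
                     (trans (vars agr y) (sym (lookup∘update′ y≢x s a)))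
  agree-update {e} {x = x} agr refl .consts f zs eq =
    trans (updateAt-minimal (constReg f) (varReg x) e constReg≢varReg) (consts agr f zs eq)

  sat-condReg : ∀ c {e s} → Agree e s → Sat (condReg c) e ⇔ Holds {S} MI c s
  sat-condReg (x == y)  agr = mk⇔
    (λ p → trans (sym (vars agr x)) (trans p (vars agr y)))
    (λ p → trans (vars agr x) (trans p (sym (vars agr y))))
  sat-condReg (c and d) agr = sat-condReg c agr ×-⇔ sat-condReg d agr
  sat-condReg (not c)   agr = ¬-cong-⇔ (sat-condReg c agr)

  callBlock-agree : ∀ x f zs view → ¬ (2 ≤ arity S f) → ∀ {e s} → Agree e s →
    Pass (wordAct MJ) (callBlock x f zs view) e ×
    Agree (post (wordAct MJ) (callBlock x f zs view) e) (s [ x ]≔ I f (map (lookup s) zs))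
  callBlock-agree x f zs (nullary eq) _ agr = tt , agree-update agr (consts agr f _ eq)
  callBlock-agree x f zs (unary eq)   _ {e} {s} agr = tt , agree-update agr (begin
    J f (cast (sym eq) (e (varReg (head (cast eq zs))) ∷ []))
      ≡⟨ cong (λ a → J f (cast (sym eq) (a ∷ []))) (vars agr _) ⟩
    J f (cast (sym eq) (lookup s (head (cast eq zs)) ∷ []))
      ≡⟨ cong (J f) (cast-[-] eq (lookup s) zs) ⟩
    J f (map (lookup s) zs)
      ≡⟨ I≗J f _ (λ eq′ → contradiction (trans (sym eq) eq′) λ ()) ⟨
    I f (map (lookup s) zs)
      ∎)
    where open ≡-Reasoning
  callBlock-agree x f zs (multi 2≤f)  ¬2≤f agr = contradiction 2≤f ¬2≤f

  block-complete : ∀ p → StraightLine p → ∀ {e s s′} → Exec p s (done s′) → Agree e s →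
                   Pass (wordAct MJ) (block p) e × Agree (post (wordAct MJ) (block p) e) s′
  block-complete skip           _ skip          agr = tt , agr
  block-complete (x ≔ y)        _ copy          agr = tt , agree-update agr (vars agr y)
  block-complete (x ≔ f ⟨ zs ⟩) (_ , _ , f≤1) call agr =
    callBlock-agree x f zs (arityView (arity S f)) (ℕ.<⇒≱ (s≤s f≤1)) agr
  block-complete (assume c)     _ (assume h)    agr = (from (sat-condReg c agr) h , tt) , agr
  block-complete (assert c)     _ (assert-ok h) agr = (from (sat-condReg c agr) h , tt) , agr
  block-complete (p ⨾ q) ((l , l′) , (b , b′) , (a , a′)) {e} {s′ = s′} (seq d d′) agr =
    let pass  , agr₁ = block-complete p (l , b , a) d agr
        pass′ , agr₂ = block-complete q (l′ , b′ , a′) d′ agr₁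
    in from (pass-++ (wordAct MJ) (block p) (block q) e) (pass , pass′) ,
       subst (λ e → Agree e s′) (sym (post-++ (wordAct MJ) (block p) (block q) e)) agr₂

  block-sound : ∀ p → StraightLine p → ∀ {e s} → Pass (wordAct MJ) (block p) e → Agree e s →
                Σ[ s′ ∈ Vec A v ] Exec p s (done s′) × Agree (post (wordAct MJ) (block p) e) s′
  block-sound skip           _ _       agr = _ , skip , agr
  block-sound (x ≔ y)        _ _       agr = _ , copy , agree-update agr (vars agr y)
  block-sound (x ≔ f ⟨ zs ⟩) (_ , _ , f≤1) _ agr =
    _ , call , proj₂ (callBlock-agree x f zs (arityView (arity S f)) (ℕ.<⇒≱ (s≤s f≤1)) agr)
  block-sound (assume c)     _ (h , _) agr = _ , assume (to (sat-condReg c agr) h) , agr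
  block-sound (assert c)     _ (h , _) agr = _ , assert-ok (to (sat-condReg c agr) h) , agr
  block-sound (p ⨾ q) ((l , l′) , (b , b′) , (a , a′)) {e} pass agr
    rewrite post-++ (wordAct MJ) (block p) (block q) e =
    let pass₁ , pass₂    = to (pass-++ (wordAct MJ) (block p) (block q) e) pass
        _ , d₁ , agr₁    = block-sound p (l , b , a) pass₁ agr
        _ , d₂ , agr₂    = block-sound q (l′ , b′ , a′) pass₂ agr₁
    in _ , seq d₁ d₂ , agr₂

  multi-agree : ∀ f zs → 2 ≤ arity S f → ∀ {e s} → Agree e s →
                J f (map e (map varReg zs)) ≡ I f (map (lookup s) zs)
  multi-agree f zs 2≤f {e} agr = trans
    (cong (J f) (trans (sym (map-∘ e varReg zs)) (map-cong (vars agr) zs)))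
    (sym (I≗J f _ (λ eq → contradiction (subst (2 ≤_) eq 2≤f) λ ())))

  -- The program state determines the registers only up to `Agree`, so the continuation must run
  -- from every agreeing state. A failure needs no continuation, as it ends in a `reach` of its own.
  Continues : Tree S (registers S v) → Outcome MI → Set
  Continues κ (done s) = ∀ {e} → Agree e s → Run MJ κ e
  Continues κ fail     = ⊤

  callTree-complete : ∀ x f zs view κ {e s} → Agree e s →
    Continues κ (done (s [ x ]≔ I f (map (lookup s) zs))) → Run MJ (callTree x f zs view κ) e
  callTree-complete x f zs (nullary eq) κ agr cont =
    let p , agr′ = callBlock-agree x f zs (nullary eq) (λ h → contradiction (subst (2 ≤_) eq h) λ ()) agr
    in p , cont agr′
  callTree-complete x f zs (unary eq) κ agr cont =
    let p , agr′ = callBlock-agree x f zs (unary eq)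
                     (λ h → contradiction (subst (2 ≤_) eq h) λ { (s≤s ()) }) agr
    in p , cont agr′
  callTree-complete x f zs (multi 2≤f) κ agr cont =
    cont (agree-update agr (multi-agree f zs 2≤f agr))

  mutual
    compile-complete : ∀ P → EveryLoopBody StraightLine P → ∀ {κ e s o} → Exec P s o →
                       Agree e s → Continues κ o → Run MJ (compile P κ) e
    compile-complete skip           _ skip    agr cont = tt , cont agr
    compile-complete (x ≔ y)        _ copy    agr cont = tt , cont (agree-update agr (vars agr y))
    compile-complete (x ≔ f ⟨ zs ⟩) _ call    agr cont =
      callTree-complete x f zs (arityView (arity S f)) _ agr cont
    compile-complete (assume c) _ (assume h)      agr cont = (from (sat-condReg c agr) h , tt) , cont agr
    compile-complete (assert c) _ (assert-ok h)   agr cont = inj₁ ((from (sat-condReg c agr) h , tt) , cont agr)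
    compile-complete (assert c) _ (assert-fail h) agr cont = inj₂ ((from (sat-condReg (not c) agr) h , tt) , tt)
    compile-complete (p ⨾ q) (h , k) (seq d d′)   agr cont =
      compile-complete p h d agr λ agr′ → compile-complete q k d′ agr′ cont
    compile-complete (p ⨾ q) (h , k) (seq-fail d) agr cont = compile-complete p h d agr tt
    compile-complete (if c then p else q) (h , k) (if-true t d)  agr cont =
      inj₁ ((from (sat-condReg c agr) t , tt) , compile-complete p h d agr cont)
    compile-complete (if c then p else q) (h , k) (if-false t d) agr cont =
      inj₂ ((from (sat-condReg (not c) agr) t , tt) , compile-complete q k d agr cont)
    compile-complete (while c loop p) h d agr cont =
      let n , r = while-complete c p h d agr cont in star-intro MJ n _ _ r

    -- The witness `n` counts the iterations completed before the exit or before the failing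
    -- iteration.
    while-complete : ∀ c p → EveryLoopBody StraightLine (while c loop p) → ∀ {κ e s o} →
      Exec (while c loop p) s o → Agree e s → Continues κ o →
      Σ[ n ∈ ℕ ] Run MJ (seq (power n (test (condReg c) ∷ block p)) (lastTest c p κ)) e
    while-complete c p h (while-exit t) agr cont =
      0 , tt , inj₁ ((from (sat-condReg (not c) agr) t , tt) , cont agr)
    while-complete c p (_ , h) (while-fail t d) agr cont =
      0 , tt , inj₂ ((from (sat-condReg c agr) t , tt) , compile-complete p h d agr tt)
    while-complete c p h {κ} {e} (while-step t d d′) agr cont =
      let pass , agr′ = block-complete p (proj₁ h) d agr
          n , r       = while-complete c p h d′ agr′ cont
          B           = test (condReg c) ∷ block p
      in suc n , from (run-++ MJ B (power n B) (lastTest c p κ) e)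
                   ((from (sat-condReg c agr) t , pass) , r)

  -- The existential counterpart of `Continues`: a given run of the tree passes through one
  -- particular register state.
  Continued : Tree S (registers S v) → Outcome MI → Set
  Continued κ (done s) = Σ[ e ∈ (Fin (registers S v) → A) ] Agree e s × Run MJ κ e
  Continued κ fail     = ⊤

  callTree-sound : ∀ x f zs view κ {e s} → Agree e s → Run MJ (callTree x f zs view κ) e →
                   Continued κ (done (s [ x ]≔ I f (map (lookup s) zs)))
  callTree-sound x f zs (nullary eq) κ agr (_ , r) =
    _ , proj₂ (callBlock-agree x f zs (nullary eq) (λ h → contradiction (subst (2 ≤_) eq h) λ ()) agr) , r
  callTree-sound x f zs (unary eq) κ agr (_ , r) =
    _ , proj₂ (callBlock-agree x f zs (unary eq)
                 (λ h → contradiction (subst (2 ≤_) eq h) λ { (s≤s ()) }) agr) , r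
  callTree-sound x f zs (multi 2≤f) κ agr r = _ , agree-update agr (multi-agree f zs 2≤f agr) , r

  mutual
    compile-sound : ∀ P → EveryLoopBody StraightLine P → ∀ {κ e s} → Agree e s →
                    Run MJ (compile P κ) e → Σ[ o ∈ Outcome MI ] Exec P s o × Continued κ o
    compile-sound skip           _ agr (_ , r) = _ , skip , _ , agr , r
    compile-sound (x ≔ y)        _ agr (_ , r) = _ , copy , _ , agree-update agr (vars agr y) , r
    compile-sound (x ≔ f ⟨ zs ⟩) _ agr r       =
      _ , call , callTree-sound x f zs (arityView (arity S f)) _ agr r
    compile-sound (assume c) _ agr ((h , _) , r) =
      _ , assume (to (sat-condReg c agr) h) , _ , agr , r
    compile-sound (assert c) _ agr (inj₁ ((h , _) , r)) =
      _ , assert-ok (to (sat-condReg c agr) h) , _ , agr , r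
    compile-sound (assert c) _ agr (inj₂ ((h , _) , r)) =
      _ , assert-fail (to (sat-condReg (not c) agr) h) , tt
    compile-sound (p ⨾ q) (h , k) agr r with compile-sound p h agr r
    ... | fail   , d , _           = fail , seq-fail d , tt
    ... | done _ , d , _ , agr′ , r′ =
      let o , d′ , cont = compile-sound q k agr′ r′ in o , seq d d′ , cont
    compile-sound (if c then p else q) (h , k) agr (inj₁ ((t , _) , r)) =
      let o , d , cont = compile-sound p h agr r in o , if-true (to (sat-condReg c agr) t) d , cont
    compile-sound (if c then p else q) (h , k) agr (inj₂ ((t , _) , r)) =
      let o , d , cont = compile-sound q k agr r in o , if-false (to (sat-condReg (not c) agr) t) d , cont
    compile-sound (while c loop p) h {κ} agr r =
      let n , r′ = star-elim MJ (test (condReg c) ∷ block p) (lastTest c p κ) r in while-sound c p h n agr r′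

    while-sound : ∀ c p → EveryLoopBody StraightLine (while c loop p) → ∀ n {κ e s} → Agree e s →
      Run MJ (seq (power n (test (condReg c) ∷ block p)) (lastTest c p κ)) e →
      Σ[ o ∈ Outcome MI ] Exec (while c loop p) s o × Continued κ o
    while-sound c p h zero agr (_ , inj₁ ((t , _) , r)) =
      _ , while-exit (to (sat-condReg (not c) agr) t) , _ , agr , r
    while-sound c p (_ , h) zero agr (_ , inj₂ ((t , _) , r))
      -- `dead` has no runs, which rules out a normal end of the body.
      with fail , d , _ ← compile-sound p h agr r =
      fail , while-fail (to (sat-condReg c agr) t) d , tt
    while-sound c p h (suc n) {κ} {e} agr r
      with (t , pass) , r′ ← to (run-++ MJ (test (condReg c) ∷ block p) _ (lastTest c p κ) e) r =
      let _ , d , agr′  = block-sound p (proj₁ h) pass agr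
          o , d′ , cont = while-sound c p h n agr′ r′
      in o , while-step (to (sat-condReg c agr) t) d d′ , cont

-- Register contents and the encoding

condVar : Cond v → Fin v
condVar (x == _)  = x
condVar (c and _) = condVar c
condVar (not c)   = condVar c

-- A failure violates some assertion, whose condition mentions a variable. Its initial value shows
-- that the carrier is inhabited and fills register zero and the registers of symbols that are not
-- constants.
failVar : ∀ {M : Model S} {P : Stmt S v} {s} → ⟨_,_⟩⇓_ M P s fail → Fin v
failVar (assert-fail {c} _) = condVar c
failVar (seq _ d)           = failVar d
failVar (seq-fail d)        = failVar d
failVar (if-true _ d)       = failVar d
failVar (if-false _ d)      = failVar d
failVar (while-step _ _ d)  = failVar d
failVar (while-fail _ d)    = failVar d

module _ (M : Model S) where

  constant : Carrier M → Symbol S → Carrier M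
  constant a f with arity S f ℕ.≟ 0
  ... | yes eq = interp M f (cast (sym eq) [])
  ... | no  _  = a

  constant-interp : ∀ a f zs → arity S f ≡ 0 → constant a f ≡ interp M f zs
  constant-interp a f zs eq with arity S f ℕ.≟ 0
  ... | yes eq′ = cong (interp M f) (cast-[] eq′ zs)
  ... | no  neq = contradiction eq neq

  -- A satisfying assignment may put anything into the registers of constants. The program is
  -- therefore run in the model that reads its constants from them.
  override : (Symbol S → Carrier M) → (f : Symbol S) → Vec (Carrier M) (arity S f) → Carrier M
  override κ f zs with arity S f ℕ.≟ 0
  ... | yes _ = κ f
  ... | no  _ = interp M f zs

  override-constant : ∀ κ f zs → arity S f ≡ 0 → κ f ≡ override κ f zs
  override-constant κ f zs eq with arity S f ℕ.≟ 0
  ... | yes _   = refl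
  ... | no  neq = contradiction eq neq

  override-other : ∀ κ f zs → arity S f ≢ 0 → override κ f zs ≡ interp M f zs
  override-other κ f zs neq with arity S f ℕ.≟ 0
  ... | yes eq = contradiction eq neq
  ... | no  _  = refl

open Registers using (varReg; constReg)

-- With `dead` as continuation, runs of the program that end normally are not accepted.
encode : (P : Stmt S v) → EUFⁿ S
encode {S} {v} P = record
  { uvars   = registers S v
  ; nvars   = loops (compile P dead)
  ; formula = runᶠ (compile P dead) id (λ _ → var)
  }

open Adequate

encode-sound : ∀ (P : Stmt S v) → Admissible P → Satisfiable (encode P) → ReachesFail P
encode-sound {S} {v} P adm (ν , M , ρ , _ , true)
  -- The outcome cannot be normal because `dead` has no runs; the initial state is read off the
  -- variable registers.
  with fail , d , _ ← compile-sound (override M (lookup ρ ∘ constReg S v)) (interp M)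
         (override-other M (lookup ρ ∘ constReg S v)) P (straightLineBodies adm) {κ = dead}
         {s = tabulate (lookup ρ ∘ varReg S v)}
         (record { vars   = λ x → sym (lookup∘tabulate (lookup ρ ∘ varReg S v) x)
                 ; consts = override-constant M (lookup ρ ∘ constReg S v) })
         (runAt⇒run M (compile P dead) (to (equivalent (runᶠ-adequate M ρ ν (compile P dead)
            (λ ι y → tt , refl))) true))
  = _ , _ , d

encode-complete : ∀ (P : Stmt S v) → Admissible P → ReachesFail P → Satisfiable (encode P)
encode-complete {S} {v} P adm (M , s , d) =
  ν , M , ρ , wellDefined adequate , from (equivalent adequate) (proj₂ counts _ (lookup∘tabulate (proj₁ counts)))
  where
  a = lookup s (failVar d)

  ρ : Vec (Carrier M) (registers S v)
  ρ = a ∷ (tabulate (constant M a) ++ᵛ s)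

  run : Run M (compile P dead) (lookup ρ)
  run = compile-complete (interp M) (interp M) (λ _ _ _ → refl) P (straightLineBodies adm) d
    (record
      { vars   = lookup-++ʳ (tabulate (constant M a)) s
      ; consts = λ f zs eq → trans (lookup-++ˡ (tabulate (constant M a)) s f)
          (trans (lookup∘tabulate (constant M a) f) (constant-interp M a f zs eq))
      })
    tt

  counts = run⇒runAt M (compile P dead) run
  ν = tabulate (proj₁ counts)
  adequate = runᶠ-adequate M ρ ν (compile P dead) {σ = id} {τ = λ _ → var} (λ ι y → tt , refl)

theorem8 : Σ[ encode ∈ (∀ {S : Signature} {v : ℕ} (P : Stmt S v) → Admissible P → EUFⁿ S) ]
    (∀ {S : Signature} {v : ℕ} (P : Stmt S v) (adm : Admissible P) →
    (Satisfiable (encode P adm) ⇔ ReachesFail P) ×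
    (Correct P ⇔ (¬ Satisfiable (encode P adm))))
theorem8 = (λ P _ → encode P) , λ P adm →
  mk⇔ (encode-sound P adm) (encode-complete P adm) ,
  mk⇔ (λ correct sat → let M , s , d = encode-sound P adm sat in correct M s d)
      (λ unsat M s d → unsat (encode-complete P adm (M , s , d)))
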